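{- For every transposition sequence $\mathbf{s}=\langle s_1,\ldots,s_m\rangle$ over $\mathbf{S}_n$, the Mind-Body Dual of $\mathbf{s}$ is the same as the Trail Dual of $\mathbf{s}$ (where the Trail Dual, a labeled graph, is viewed as a transposition sequence).
   Context: $\mathbf{S}_n$ is the symmetric group on $[n]=\{1,\ldots,n\}$; permutations are multiplied from left to right (in $p\cdot q$, $p$ is applied first). A transposition sequence over $\mathbf{S}_n$ is a finite sequence $\langle s_1,\ldots,s_m\rangle$ of transpositions of $\mathbf{S}_n$. Mind-Body Dual: A Mind-Body Assignment over $n$ is a permutation $A\in\mathbf{S}_n$, thought of as mapping each mind $M$ to the body $A(M)$; one says $M$ is above $A(M)$. For a transposition $(x,y)$, the body-swapping operation turns $A$ into the assignment in which the bodies $x$ and $y$ are exchanged (the mind that was above $x$ is now above $y$ and vice versa; all else unchanged). Given $\mathbf{s}=\langle s_1,\ldots,s_m\rangle$, let $A_0$ be the identity and let $A_k$ be the result of applying to $A_{k-1}$ the body-swapping operation with $s_k$. The Mind-Body Dual of $\mathbf{s}$ is $\langle s_1',\ldots,s_m'\rangle$, where, if $s_k=(x,y)$, then $s_k'=(x',y')$ with $x'$ above $x$ and $y'$ above $y$ in $A_{k-1}$. Graphs: a graph is finite and loopless, with multi-edges allowed. A labeled graph has its $n$ vertices labeled bijectively by $[n]$ and its $m$ edges labeled bijectively by $[m]$. Transposition sequences over $\mathbf{S}_n$ of length $m$ are identified with labeled graphs on vertex set $[n]$ with $m$ edges: $s_i=(x_i,y_i)$ corresponds to an edge labeled $i$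 between $x_i$ and $y_i$. A trail is a sequence $\langle v_1,e_1,v_2,\ldots,e_{k-1},v_k\rangle$ with $e_i$ an edge joining $v_i$ and $v_{i+1}$ and no edge repeated (a single vertex is allowed). Trail Dual: for a vertex $u$, the Minimal Increasing Greedy Trail (MIGT) $T_u$ is the trail starting at $u$ that at each step takes, among the edges incident to the current vertex whose labels are larger than those of all previously used edges, the one with the smallest label, and stops when there is no such edge. (Each edge is used by exactly two of the trails $T_u$, $u\in[n]$.) The Trail Dual of a labeled graph $G$ is the labeled graph $G'$ on the same vertex set in which, for each label $k$, there is an edge labeled $k$ between the two vertices $x,y$ such that $T_x$ and $T_y$ both use the edge of $G$ labeled $k$. -}

module Defs where

open import Data.Fin.Base using (Fin; zero; suc; _≤_; _<_; _>_)
open import Data.Fin.Induction using (>-wellFounded)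
open import Data.Fin.Permutation
  using (Permutation′; id; transpose; _∘ₚ_; _⟨$⟩ʳ_; _⟨$⟩ˡ_; inverseʳ)
open import Data.Fin.Properties using (_≟_; _<?_; <⇒≢)
open import Data.List.Base using (List; []; _∷_)
open import Data.List.Membership.Propositional using (_∈_)
open import Data.List.Relation.Unary.All as All using (All; []; _∷_)
open import Data.List.Relation.Unary.AllPairs using ([]; _∷_)
open import Data.List.Relation.Unary.Unique.Propositional using (Unique)
open import Data.Nat.Base using (ℕ; zero; suc; z≤n; s≤s)
open import Data.Product.Base using (Σ; ∃; _×_; _,_; proj₁; proj₂)
open import Data.Sum.Base using (_⊎_; inj₁; inj₂)
open import Data.Vec.Base using (Vec; []; _∷_; lookup; tabulate)
open import Data.Vec.Relation.Binary.Pointwise.Inductive using (Pointwise)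
open import Function.Base using (_∘_)
open import Function.Bundles using (_⇔_)
open import Induction.WellFounded using (Acc; acc)
open import Level using (0ℓ)
open import Relation.Binary.PropositionalEquality.Core
  using (_≡_; _≢_; refl; sym; trans; cong)
open import Relation.Nullary using (¬_; yes; no; contradiction)
open import Relation.Nullary.Decidable using (_×-dec_; _⊎-dec_)
open import Relation.Unary using (Pred; Decidable)

private
  variable
    n m : ℕ

-- The two orderings of the same pair denote the same transposition, so
-- transpositions are compared with _≈ᵗ_ below, never with _≡_.

record Transposition (n : ℕ) : Set where
  constructor ⟨_,_⟩[_]
  field
    fst      : Fin n
    snd      : Fin n
    distinct : fst ≢ snd

open Transposition public

infix 4 _≈ᵗ_ _≋_

_≈ᵗ_ : Transposition n → Transposition n → Set
s ≈ᵗ t = (fst s ≡ fst t × snd s ≡ snd t) ⊎ (fst s ≡ snd t × snd s ≡ fst t)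

TranspositionSequence : ℕ → ℕ → Set
TranspositionSequence n m = Vec (Transposition n) m

_≋_ : TranspositionSequence n m → TranspositionSequence n m → Set
_≋_ = Pointwise _≈ᵗ_

-- A ⟨$⟩ʳ M is the body below the mind M, and A ⟨$⟩ˡ x is the mind above
-- the body x.

Assignment : ℕ → Set
Assignment n = Permutation′ n

-- _∘ₚ_ composes from left to right: first A, then the exchange of bodies.

swapBodies : Transposition n → Assignment n → Assignment n
swapBodies s A = A ∘ₚ transpose (fst s) (snd s)

mindsAbove : Assignment n → Transposition n → Transposition n
mindsAbove A s =
  ⟨ A ⟨$⟩ˡ fst s , A ⟨$⟩ˡ snd s ⟩[ distinct s ∘ bodies-agree ]
  where
  bodies-agree : A ⟨$⟩ˡ fst s ≡ A ⟨$⟩ˡ snd s → fst s ≡ snd s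
  bodies-agree eq =
    trans (sym (inverseʳ A)) (trans (cong (A ⟨$⟩ʳ_) eq) (inverseʳ A))

mindBodyDualFrom : Assignment n →
                   TranspositionSequence n m → TranspositionSequence n m
mindBodyDualFrom A []      = []
mindBodyDualFrom A (s ∷ ss) =
  mindsAbove A s ∷ mindBodyDualFrom (swapBodies s A) ss

mindBodyDual : TranspositionSequence n m → TranspositionSequence n m
mindBodyDual = mindBodyDualFrom id

-- Vertices are identified with their labels in Fin n and edges with
-- their labels in Fin m; a graph gives the two (distinct) ends of each
-- edge.  Parallel edges are allowed.

LabeledGraph : ℕ → ℕ → Set
LabeledGraph n m = Fin m → Transposition n

toGraph : TranspositionSequence n m → LabeledGraph n m
toGraph = lookup

toSequence : LabeledGraph n m → TranspositionSequence n m
toSequence = tabulate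

module _ (G : LabeledGraph n m) where

  Incident : Fin n → Fin m → Set
  Incident u e = u ≡ fst (G e) ⊎ u ≡ snd (G e)

  Joins : Fin m → Fin n → Fin n → Set
  Joins e u v = (u ≡ fst (G e) × v ≡ snd (G e)) ⊎ (u ≡ snd (G e) × v ≡ fst (G e))

  data Walk : Fin n → Set where
    stop : ∀ {u} → Walk u
    step : ∀ {u v} (e : Fin m) → Joins e u v → Walk v → Walk u

  edges : ∀ {u} → Walk u → List (Fin m)
  edges stop         = []
  edges (step e _ w) = e ∷ edges w

  IsTrail : ∀ {u} → Walk u → Set
  IsTrail w = Unique (edges w)

  Admissible : List (Fin m) → Fin n → Fin m → Set
  Admissible used u e = Incident u e × All (_< e) used

  -- Greedy used w: w obeys the greedy rule throughout, when the edges in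
  -- the list used have been traversed before w starts.

  data Greedy (used : List (Fin m)) : ∀ {u} → Walk u → Set where
    stop : ∀ {u} → (∀ e → ¬ Admissible used u e) → Greedy used (stop {u})
    step : ∀ {u v} {e} {j : Joins e u v} {w : Walk v} →
           Admissible used u e →
           (∀ e′ → Admissible used u e′ → e ≤ e′) →
           Greedy (e ∷ used) w →
           Greedy used (step e j w)

  record MIGT (u : Fin n) : Set where
    field
      walk    : Walk u
      isTrail : IsTrail walk
      greedy  : Greedy [] walk

private
  smallest : ∀ {m} {P : Pred (Fin m) 0ℓ} → Decidable P →
             (∀ i → ¬ P i) ⊎ (∃ λ i → P i × (∀ j → P j → i ≤ j))
  smallest {zero}  P? = inj₁ λ ()
  smallest {suc m} P? with P? zero
  ... | yes p₀ = inj₂ (zero , p₀ , λ _ _ → z≤n)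
  ... | no ¬p₀ with smallest (P? ∘ suc)
  ...   | inj₁ none          = inj₁ λ { zero → ¬p₀ ; (suc i) → none i }
  ...   | inj₂ (i , pᵢ , min) = inj₂ (suc i , pᵢ , λ
    { zero p → contradiction p ¬p₀
    ; (suc j) p → s≤s (min j p) })

module _ (G : LabeledGraph n m) where

  private
    GreedyWalk : List (Fin m) → Fin n → Set
    GreedyWalk used u = Σ (Walk G u) (Greedy G used)

    admissible? : ∀ used u → Decidable (Admissible G used u)
    admissible? used u e =
      (u ≟ fst (G e) ⊎-dec u ≟ snd (G e)) ×-dec All.all? (_<? e) used

    otherEnd : ∀ {u e} → Incident G u e → ∃ (Joins G e u)
    otherEnd (inj₁ p) = _ , inj₁ (p , refl)
    otherEnd (inj₂ p) = _ , inj₂ (p , refl)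

    extend : ∀ used u →
             (∀ e v → Admissible G used u e → GreedyWalk (e ∷ used) v) →
             GreedyWalk used u
    extend used u continue with smallest (admissible? used u)
    ... | inj₁ none = stop , stop none
    ... | inj₂ (e , adm , min) with otherEnd (proj₁ adm)
    ...   | v , j with continue e v adm
    ...     | w , g = step e j w , step adm min g

    walkAfter : ∀ e used u → Acc _>_ e → GreedyWalk (e ∷ used) u
    walkAfter e used u (acc rs) = extend (e ∷ used) u λ e′ v adm →
      walkAfter e′ (e ∷ used) v (rs (All.head (proj₂ adm)))

    greedyWalk : ∀ u → GreedyWalk [] u
    greedyWalk u = extend [] u λ e v _ → walkAfter e [] v (>-wellFounded e)

  greedy⇒larger : ∀ {used u} {w : Walk G u} → Greedy G used w →
                  All (λ e → All (_< e) used) (edges G w)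
  greedy⇒larger (stop _)       = []
  greedy⇒larger (step adm _ g) = proj₂ adm ∷ All.map All.tail (greedy⇒larger g)

  greedy⇒trail : ∀ {used u} {w : Walk G u} → Greedy G used w → IsTrail G w
  greedy⇒trail (stop _)     = []
  greedy⇒trail (step _ _ g) =
    All.map (<⇒≢ ∘ All.head) (greedy⇒larger g) ∷ greedy⇒trail g

  migt : ∀ u → MIGT G u
  migt u with greedyWalk u
  ... | w , g = record { walk = w ; isTrail = greedy⇒trail g ; greedy = g }

  Uses : Fin n → Fin m → Set
  Uses u k = k ∈ edges G (MIGT.walk (migt u))

-- The ends of the edge labeled k in G′ are exactly the vertices u whose
-- trail T_u in G uses the edge labeled k.  As the ends of an edge are
-- distinct, there must be exactly two such vertices, and they determine
-- G′ up to the order in which the ends of each edge are listed.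

infix 4 _IsTrailDualOf_

_IsTrailDualOf_ : LabeledGraph n m → LabeledGraph n m → Set
G′ IsTrailDualOf G = ∀ k u → Incident G′ u k ⇔ Uses G u k

{-# OPTIONS --safe #-}

-- Read the sequence one transposition at a time.  In both duals a mind
-- that currently sits at x or y is moved to the other end by the first
-- transposition (x , y), and every other mind stays put.  Hence the greedy
-- trail of v in the graph of s ∷ ss is the greedy trail of the image of v
-- under s in the graph of ss, preceded by the first edge exactly when v is
-- one of its ends.  So T_u uses edge k iff the body of u just before the
-- k-th exchange is one of the two exchanged, that is, iff u is an end of
-- edge k of the Mind-Body Dual.  Finally a transposition is determined by
-- its set of ends.

module Submission where

open import Data.Fin.Base using (Fin; zero; suc; _<_)
open import Data.Fin.Permutation
  using (id; transpose; _⟨$⟩ʳ_; _⟨$⟩ˡ_; inverseˡ; inverseʳ)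
open import Data.Fin.Properties using (_≟_)
open import Data.List.Base using (List; []; _∷_; map)
open import Data.List.Membership.Propositional using (_∈_; _∉_)
open import Data.List.Membership.Propositional.Properties using (∈-map⁺; ∈-map⁻)
open import Data.List.Relation.Unary.All using (All; []; _∷_)
open import Data.List.Relation.Unary.Any using (here; there)
open import Data.Nat.Base using (ℕ; suc; z<s; s<s; s<s⁻¹; s≤s⁻¹)
open import Data.Product.Base using (∃; _×_; _,_; proj₁; proj₂)
open import Data.Sum.Base as Sum using (_⊎_; inj₁; inj₂)
open import Data.Vec.Base using ([]; _∷_; lookup)
open import Data.Vec.Properties using (lookup∘tabulate)
open import Data.Vec.Relation.Binary.Pointwise.Extensional
  using (ext; extensional⇒inductive)
import Data.Vec.Relation.Binary.Pointwise.Inductive as Pointwise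
open import Function.Base using (_∘_)
open import Function.Bundles using (_⇔_; mk⇔; Equivalence)
open import Function.Construct.Composition using (_⇔-∘_)
open import Function.Construct.Symmetry using (⇔-sym)
open import Relation.Binary.PropositionalEquality
  using (_≡_; refl; sym; trans; cong; subst)
open import Relation.Nullary using (¬_; yes; no; contradiction)

open import Defs

open Equivalence using (to; from)

private
  variable
    n m : ℕ

transpose-fst : (i j : Fin n) → transpose i j ⟨$⟩ʳ i ≡ j
transpose-fst i j with i ≟ i
... | yes _  = refl
... | no i≢i = contradiction refl i≢i

transpose-snd : (i j : Fin n) → transpose i j ⟨$⟩ʳ j ≡ i
transpose-snd i j with j ≟ i
... | yes j≡i = j≡i
... | no _ with j ≟ j
...   | yes _  = refl
...   | no j≢j = contradiction refl j≢j

transpose-fixes : {i j u : Fin n} → ¬ (u ≡ i ⊎ u ≡ j) → transpose i j ⟨$⟩ʳ u ≡ u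
transpose-fixes {i = i} {j} {u} u∉ij with u ≟ i
... | yes u≡i = contradiction (inj₁ u≡i) u∉ij
... | no _ with u ≟ j
...   | yes u≡j = contradiction (inj₂ u≡j) u∉ij
...   | no _    = refl

HasEnd : Transposition n → Fin n → Set
HasEnd t u = u ≡ fst t ⊎ u ≡ snd t

≈ᵗ⇒sameEnds : (t t′ : Transposition n) → t ≈ᵗ t′ → ∀ u → HasEnd t u ⇔ HasEnd t′ u
≈ᵗ⇒sameEnds t t′ (inj₁ (refl , refl)) u = mk⇔ (λ p → p) (λ p → p)
≈ᵗ⇒sameEnds t t′ (inj₂ (refl , refl)) u = mk⇔ Sum.swap Sum.swap

-- The ends of `t` are distinct, so they cannot both equal the same end of `t′`; the two remaining
-- cases are the two orderings.
sameEnds⇒≈ᵗ : (t t′ : Transposition n) → (∀ u → HasEnd t u ⇔ HasEnd t′ u) → t ≈ᵗ t′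
sameEnds⇒≈ᵗ t t′ same with to (same (fst t)) (inj₁ refl) | to (same (snd t)) (inj₂ refl)
... | inj₁ p | inj₁ q = contradiction (trans p (sym q)) (distinct t)
... | inj₁ p | inj₂ q = inj₁ (p , q)
... | inj₂ p | inj₁ q = inj₂ (p , q)
... | inj₂ p | inj₂ q = contradiction (trans p (sym q)) (distinct t)

-- This moves the end condition from minds to bodies, which are the vertices that the trails visit;
-- it rests on `A` being a bijection.
mindsAbove-ends : (A : Assignment n) (t : Transposition n) (u : Fin n) →
                  HasEnd (mindsAbove A t) u ⇔ HasEnd t (A ⟨$⟩ʳ u)
mindsAbove-ends A t u = mk⇔ (Sum.map down down) (Sum.map up up)
  where
  down : ∀ {x} → u ≡ A ⟨$⟩ˡ x → A ⟨$⟩ʳ u ≡ x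
  down refl = inverseʳ A
  up : ∀ {x} → A ⟨$⟩ʳ u ≡ x → u ≡ A ⟨$⟩ˡ x
  up refl = sym (inverseˡ A)

zero∉map-suc : {es : List (Fin m)} → zero ∉ map suc es
zero∉map-suc z∈ with ∈-map⁻ suc z∈
... | _ , _ , ()

suc∈map-suc : {k : Fin m} {es : List (Fin m)} → suc k ∈ map suc es ⇔ k ∈ es
suc∈map-suc {k = k} {es} = mk⇔ unmap (∈-map⁺ suc)
  where
  unmap : suc k ∈ map suc es → k ∈ es
  unmap k∈ with ∈-map⁻ suc k∈
  ... | _ , k∈es , refl = k∈es

module _ (G : LabeledGraph n (suc m)) where

  -- The greedy rule depends on the list of used edges only through the set
  -- of labels exceeding all of them.
  SameLarger : List (Fin (suc m)) → List (Fin m) → Set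
  SameLarger used used′ = ∀ (e : Fin m) → All (_< suc e) used ⇔ All (_< e) used′

  -- If edge `zero` cannot be taken now, it never can: any step uses some `suc e`, which zero does
  -- not exceed. So all labels used are successors, and lowering them by one keeps their order and
  -- hence the greedy choices.
  dropZero : ∀ {used used′ u} {w : Walk G u} → SameLarger used used′ →
             ¬ Admissible G used u zero → Greedy G used w →
             ∃ λ (w′ : Walk (G ∘ suc) u) → Greedy (G ∘ suc) used′ w′ ×
               edges G w ≡ map suc (edges (G ∘ suc) w′)
  dropZero same ¬adm₀ (stop none) =
    stop , stop (λ e (inc , larger) → none (suc e) (inc , from (same e) larger)) , refl
  dropZero same ¬adm₀ (step {e = zero} adm _ _) = contradiction adm ¬adm₀
  dropZero {used} {used′} same ¬adm₀ (step {e = suc e} {j = j} (inc , larger) min g)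
    with dropZero same-∷ (λ { (_ , () ∷ _) }) g
    where
    same-∷ : SameLarger (suc e ∷ used) (e ∷ used′)
    same-∷ e′ = mk⇔ (λ { (p ∷ ps) → s<s⁻¹ p ∷ to (same e′) ps })
                    (λ { (p ∷ ps) → s<s p ∷ from (same e′) ps })
  ... | w′ , g′ , eq =
    step e j w′ ,
    step (inc , to (same e) larger)
         (λ e′ (inc′ , larger′) → s≤s⁻¹ (min (suc e′) (inc′ , from (same e′) larger′)))
         g′ ,
    cong (suc e ∷_) eq

  -- Recording only membership in the edge list lets walks with and without edge `zero` share one
  -- form.
  record FirstEdgeSplit {u} (w : Walk G u) : Set where
    field
      {end}      : Fin n
      end≡       : end ≡ transpose (fst (G zero)) (snd (G zero)) ⟨$⟩ʳ u
      rest       : Walk (G ∘ suc) end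
      restGreedy : Greedy (G ∘ suc) [] rest
      zero∈      : zero ∈ edges G w ⇔ Incident G u zero
      suc∈       : ∀ k → suc k ∈ edges G w ⇔ k ∈ edges (G ∘ suc) rest

  private
    skip : ∀ {u} {w : Walk G u} → ¬ Incident G u zero → Greedy G [] w → FirstEdgeSplit w
    skip ¬inc g with dropZero (λ _ → mk⇔ (λ _ → []) (λ _ → [])) (¬inc ∘ proj₁) g
    ... | w′ , g′ , eq = record
      { end≡       = sym (transpose-fixes ¬inc)
      ; rest       = w′
      ; restGreedy = g′
      ; zero∈      = mk⇔ (λ z∈ → contradiction (subst (zero ∈_) eq z∈) zero∉map-suc)
                         (λ inc → contradiction inc ¬inc)
      ; suc∈       = λ k → subst (λ es → suc k ∈ es ⇔ _) (sym eq) suc∈map-suc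
      }

  splitFirstEdge : ∀ {u} {w : Walk G u} → Greedy G [] w → FirstEdgeSplit w
  splitFirstEdge g@(stop none) = skip (λ inc → none zero (inc , [])) g
  -- If edge `zero` touched `u`, minimality would force it to be the first edge.
  splitFirstEdge g@(step {e = suc _} _ min _) =
    skip (λ inc → contradiction (min zero (inc , [])) λ ()) g
  splitFirstEdge (step {e = zero} {j = j} adm _ g)
    -- Having used only label `zero` rules out no successor label, so the tail is greedy in the
    -- shifted graph from an empty used list.
    with dropZero (λ _ → mk⇔ (λ _ → []) (λ _ → z<s ∷ [])) (λ { (_ , () ∷ _) }) g
  ... | w′ , g′ , eq = record
    { end≡       = otherEnd≡ j
    ; rest       = w′
    ; restGreedy = g′
    ; zero∈      = mk⇔ (λ _ → proj₁ adm) (λ _ → here refl)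
    ; suc∈       = λ k → mk⇔
        (λ { (here ()) ; (there k∈) → to suc∈map-suc (subst (suc k ∈_) eq k∈) })
        (λ k∈ → there (subst (suc k ∈_) (sym eq) (from suc∈map-suc k∈)))
    }
    where
    otherEnd≡ : ∀ {u v} → Joins G zero u v →
                v ≡ transpose (fst (G zero)) (snd (G zero)) ⟨$⟩ʳ u
    otherEnd≡ (inj₁ (refl , refl)) = sym (transpose-fst (fst (G zero)) (snd (G zero)))
    otherEnd≡ (inj₂ (refl , refl)) = sym (transpose-snd (fst (G zero)) (snd (G zero)))

-- An arbitrary `A` replaces the identity so that induction on the sequence goes through: `v` is the
-- body below mind `u` when `s` begins.
greedy-uses : (s : TranspositionSequence n m) (A : Assignment n) {u v : Fin n}
              {w : Walk (toGraph s) v} → v ≡ A ⟨$⟩ʳ u → Greedy (toGraph s) [] w →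
              ∀ k → Incident (toGraph (mindBodyDualFrom A s)) u k ⇔ k ∈ edges (toGraph s) w
greedy-uses (t ∷ s) A {u} refl g zero =
  ⇔-sym (FirstEdgeSplit.zero∈ (splitFirstEdge _ g)) ⇔-∘ mindsAbove-ends A t u
greedy-uses (t ∷ s) A refl g (suc k) =
  -- `end≡` fits because `swapBodies t A` is by definition `A` followed by the transposition.
  ⇔-sym (suc∈ k) ⇔-∘ greedy-uses s (swapBodies t A) end≡ restGreedy k
  where open FirstEdgeSplit (splitFirstEdge _ g)

mindBodyDual-isTrailDual : (s : TranspositionSequence n m) →
                           toGraph (mindBodyDual s) IsTrailDualOf toGraph s
mindBodyDual-isTrailDual s k u =
  greedy-uses s id refl (MIGT.greedy (migt (toGraph s) u)) k

theorem4p2 : (n m : ℕ) (s : TranspositionSequence n m) (G′ : LabeledGraph n m) →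
    G′ IsTrailDualOf toGraph s ⇔ mindBodyDual s ≋ toSequence G′
theorem4p2 n m s G′ = mk⇔
  -- In both graphs the ends of edge `k` are the vertices whose trails use it.
  (λ dual → extensional⇒inductive (ext λ k →
    subst (lookup (mindBodyDual s) k ≈ᵗ_) (sym (lookup∘tabulate G′ k))
      (sameEnds⇒≈ᵗ (lookup (mindBodyDual s) k) (G′ k) λ u →
        ⇔-sym (dual k u) ⇔-∘ mindBodyDual-isTrailDual s k u)))
  (λ same k u → mindBodyDual-isTrailDual s k u ⇔-∘
    ⇔-sym (≈ᵗ⇒sameEnds (lookup (mindBodyDual s) k) (G′ k)
      (subst (lookup (mindBodyDual s) k ≈ᵗ_) (lookup∘tabulate G′ k)
        (Pointwise.lookup same k)) u))
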